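{- Let $P$ be a poset and $n$ be a positive integer. The following properties are equivalent: (i) the order on $P$ is the intersection of $n$ scattered linear orders; (ii) $\overline{N(P)}$, ordered by inclusion, is embeddable into a (direct) product of $n$ scattered linear orders. Moreover, if one of these conditions holds, then $\overline{N(P)}$ is topologically scattered.
   Context: A poset (or its order) is scattered if it contains no induced subposet isomorphic to the chain of rational numbers. A poset is embeddable in another if it is isomorphic to an induced subposet of it; direct products are ordered componentwise. A topological space is (topologically) scattered if every non-empty subset has at least one isolated point in the induced topology. For $x\in P$ let $\downarrow x:=\{y\in P: y\leq x\}$. $N(P)$, the MacNeille completion of $P$, is the set of all intersections of families of sets $\downarrow x$ ($x\in P$), the intersection of the empty family being $P$, ordered by inclusion. The power set $\mathfrak{P}(P)$ is identified with $2^P$ with the product topology ($2$ discrete), and $\overline{N(P)}$ is the topological closure of $N(P)$ in $\mathfrak{P}(P)$, with the induced topology and ordered by inclusion. -}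

module Defs where

open import Level using (Level; suc; _⊔_)
open import Data.Bool.Base using (Bool; true)
open import Data.Bool.Properties using (⇔→≡)
open import Data.Fin.Base using (Fin)
open import Data.List.Base using (List)
open import Data.List.Relation.Unary.All using (All)
open import Data.Nat.Base using (ℕ)
open import Data.Product.Base using (Σ; ∃; _×_; _,_; proj₁)
import Data.Rational.Properties as ℚ
open import Function.Bundles using (Func; _⇔_; mk⇔)
open import Relation.Binary.Bundles using (Poset; TotalOrder; DecTotalOrder)
open import Relation.Binary.Core using (Rel)
open import Relation.Binary.Structures using (IsTotalOrder)
import Relation.Binary.Construct.On as On
open import Relation.Binary.Morphism.Structures using (IsOrderMonomorphism)
open import Relation.Binary.PropositionalEquality.Core
  using (_≡_; refl; sym; trans)
open import Relation.Binary.PropositionalEquality.Properties using (setoid)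
open import Relation.Nullary.Negation.Core using (¬_)
open import Relation.Unary using (Pred; _∈_; _⊆_; _≐_; Satisfiable; ⋂)

private
  variable
    a ℓ₁ ℓ₂ b ℓ₃ ℓ₄ ℓ : Level

Embeds : Poset a ℓ₁ ℓ₂ → Poset b ℓ₃ ℓ₄ → Set (a ⊔ ℓ₁ ⊔ ℓ₂ ⊔ b ⊔ ℓ₃ ⊔ ℓ₄)
Embeds P Q = ∃ λ (f : P.Carrier → Q.Carrier) →
  IsOrderMonomorphism P._≈_ Q._≈_ P._≤_ Q._≤_ f
  where
  module P = Poset P
  module Q = Poset Q

Scattered : Poset a ℓ₁ ℓ₂ → Set (a ⊔ ℓ₁ ⊔ ℓ₂)
Scattered P = ¬ Embeds (DecTotalOrder.poset ℚ.≤-decTotalOrder) P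

Product : ∀ {n} → (Fin n → Poset a ℓ₁ ℓ₂) → Poset a ℓ₁ ℓ₂
Product {n = n} C = record
  { Carrier = ∀ i → C.Carrier i
  ; _≈_     = λ x y → ∀ i → C._≈_ i (x i) (y i)
  ; _≤_     = λ x y → ∀ i → C._≤_ i (x i) (y i)
  ; isPartialOrder = record
    { isPreorder = record
      { isEquivalence = record
        { refl  = λ i → C.Eq.refl i
        ; sym   = λ p i → C.Eq.sym i (p i)
        ; trans = λ p q i → C.Eq.trans i (p i) (q i)
        }
      ; reflexive = λ p i → C.reflexive i (p i)
      ; trans     = λ p q i → C.trans i (p i) (q i)
      }
    ; antisym = λ p q i → C.antisym i (p i) (q i)
    }
  }
  where module C (i : Fin n) = Poset (C i)

IsIntersectionOfScatteredLinearOrders : ℕ → Poset ℓ ℓ ℓ → Set (suc ℓ)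
IsIntersectionOfScatteredLinearOrders {ℓ} n P =
  Σ (Fin n → Rel Carrier ℓ) λ R →
  Σ (∀ i → IsTotalOrder _≈_ (R i)) λ isTotal →
    (∀ i → Scattered (TotalOrder.poset (record { isTotalOrder = isTotal i })))
    × (∀ x y → x ≤ y ⇔ (∀ i → R i x y))
  where open Poset P

EmbedsInProductOfScatteredLinearOrders :
  (ℓ : Level) → ℕ → Poset a ℓ₁ ℓ₂ → Set (suc ℓ ⊔ a ⊔ ℓ₁ ⊔ ℓ₂)
EmbedsInProductOfScatteredLinearOrders ℓ n Q =
  Σ (Fin n → TotalOrder ℓ ℓ ℓ) λ C →
    (∀ i → Scattered (TotalOrder.poset (C i)))
    × Embeds Q (Product (λ i → TotalOrder.poset (C i)))

-- Subsets of P are the elements of 2 ^ P, that is, the Bool-valued functions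
-- on P that respect its equality.

module _ (P : Poset ℓ ℓ ℓ) where
  open Poset P using (Carrier; _≤_; module Eq)

  2^ : Set ℓ
  2^ = Func Eq.setoid (setoid Bool)

  member : 2^ → Pred Carrier _
  member A x = Func.to A x ≡ true

  𝔓 : Poset ℓ ℓ ℓ
  𝔓 = record
    { Carrier = 2^
    ; _≈_     = λ A B → ∀ x → Func.to A x ≡ Func.to B x
    ; _≤_     = λ A B → ∀ x → x ∈ member A → x ∈ member B
    ; isPartialOrder = record
      { isPreorder = record
        { isEquivalence = record
          { refl  = λ x → refl
          ; sym   = λ p x → sym (p x)
          ; trans = λ p q x → trans (p x) (q x)
          }
        ; reflexive = λ p x → trans (sym (p x))
        ; trans     = λ p q x x∈A → q x (p x x∈A)
        }
      ; antisym = λ p q x → ⇔→≡ (mk⇔ (p x) (q x))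
      }
    }

  -- The cylinders { B | B agrees with A at each point of F }, for F finite,
  -- are a base of the product topology.

  IsOpen : Pred 2^ ℓ → Set ℓ
  IsOpen U = ∀ A → A ∈ U → Σ (List Carrier) λ F →
    ∀ B → All (λ x → Func.to A x ≡ Func.to B x) F → B ∈ U

  Closure : Pred 2^ (suc ℓ) → Pred 2^ (suc ℓ)
  Closure X A = ∀ (U : Pred 2^ ℓ) → IsOpen U → A ∈ U →
    Σ 2^ λ B → B ∈ X × B ∈ U

  IsIsolatedIn : Pred 2^ (suc ℓ) → Pred 2^ (suc ℓ)
  IsIsolatedIn S A = A ∈ S × Σ (Pred 2^ ℓ) λ U → IsOpen U × A ∈ U ×
    (∀ B → B ∈ S → B ∈ U → Poset._≈_ 𝔓 B A)

  TopologicallyScattered : Pred 2^ (suc ℓ) → Set (suc (suc ℓ))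
  TopologicallyScattered X = ∀ (S : Pred 2^ (suc ℓ)) → S ⊆ X →
    Satisfiable S → Satisfiable (IsIsolatedIn S)

  ↓ : Carrier → Pred Carrier ℓ
  ↓ x y = y ≤ x

  N : Pred 2^ (suc ℓ)
  N A = Σ (Set ℓ) λ I → Σ (I → Carrier) λ f →
    member A ≐ ⋂ I (λ i → ↓ (f i))

  N̄ : Pred 2^ (suc ℓ)
  N̄ = Closure N

  N̄-poset : Poset (suc ℓ) ℓ ℓ
  N̄-poset = On.poset 𝔓 (proj₁ {B = N̄})

{-# OPTIONS --safe #-}
module Submission where

-- By Cantor's argument, a chain is scattered iff it carries no nonempty
-- relation ◁ refining < and dense in the sense that x ◁ y implies x ◁ z ◁ y
-- for some z.
--
-- If ≤ is the intersection of scattered linear orders Lᵢ, every A in N̄ P is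
-- the intersection of the initial segments ↓ᵢ A it generates in the Lᵢ, so
-- A ↦ (↓ᵢ A)ᵢ embeds N̄ P into a product of chains of initial segments, which
-- are scattered.  Conversely an embedding of P in a product of n scattered
-- chains yields the n lexicographic orders having a given coordinate first;
-- a copy of ℚ in one of them could be restricted to an interval on which all
-- coordinates are constant, which is absurd.
--
-- Let S ⊆ N̄ P be dense in itself.  Every somewhere dense subset of S is split
-- by some point x into two somewhere dense parts, according to x ∈ A or
-- x ∉ A.  On the other hand, by Cantor's argument it contains a somewhere
-- dense subset which no condition x ∈ ↓ᵢ A splits, for any i.  This is
-- absurd, since x ∉ A means x ∉ ↓ᵢ A for some i and nowhere dense sets are
-- closed under finite unions.

open import Defs
open import Level using (Level; _⊔_)
open import Axiom.ExcludedMiddle using (ExcludedMiddle)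
open import Axiom.DoubleNegationElimination using (em⇒dne)
open import Data.Bool.Base using (Bool; true; false)
open import Data.Bool.Properties using (¬-not; _≟_)
open import Data.Fin.Base using (Fin; zero; suc)
open import Data.Integer.Base as ℤ using (+_; -[1+_]; _⊖_)
open import Data.List.Base using (List; []; _∷_; tabulate; allFin)
open import Data.List.Membership.Propositional.Properties using (∈-allFin)
open import Data.List.Relation.Unary.All as All using (All; []; _∷_)
open import Data.List.Relation.Unary.All.Properties using (tabulate⁺; tabulate⁻)
open import Data.List.Relation.Unary.Any using (there)
open import Data.Nat.Base using (ℕ; zero; suc; _+_; z≤n; s≤s; NonZero)
open import Data.Nat.Properties using (+-identityʳ; +-suc; suc-injective)
open import Data.Product.Base using (∃; ∃₂; _×_; _,_; proj₁; proj₂)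
open import Data.Rational.Base as ℚ using (ℚ; mkℚ; 0ℚ; 1ℚ)
import Data.Rational.Properties as ℚ
open import Data.Sum.Base using (_⊎_; inj₁; inj₂; [_,_]′)
open import Data.Unit.Polymorphic.Base using (⊤)
open import Function.Base using (_∘_; id; case_of_)
open import Function.Bundles using (Func; _⇔_; mk⇔; Equivalence)
open import Relation.Binary.Bundles using (Poset; TotalOrder; DecTotalOrder)
open import Relation.Binary.Core using (Rel)
import Relation.Binary.Construct.On as On
open import Relation.Binary.Definitions using (tri<; tri≈; tri>)
open import Relation.Binary.Morphism.Construct.Composition
  using (isOrderMonomorphism)
open import Relation.Binary.Morphism.Structures
  using (IsOrderMonomorphism)
open import Relation.Binary.PropositionalEquality
  using (_≡_; refl; sym; trans; cong)
open import Relation.Binary.Structures using (IsTotalOrder)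
open import Relation.Nullary.Decidable using (Dec; yes; no; does; does-⇔; dec-true)
open import Relation.Nullary.Negation.Core using (¬_; contradiction)
open import Relation.Unary
  using (Pred; _∈_; _∉_; _⊆_; _∩_; ∁; Satisfiable)

private
  variable
    a b ℓ ℓ₁ ℓ₂ ℓ₃ ℓ₄ : Level

-- Order embeddings

ℚ-poset : Poset _ _ _
ℚ-poset = DecTotalOrder.poset ℚ.≤-decTotalOrder

0<1 : 0ℚ ℚ.< 1ℚ
0<1 = ℚ.*<* (ℤ.+<+ (s≤s z≤n))

module _ (P : Poset a ℓ₁ ℓ₂) (Q : Poset b ℓ₃ ℓ₄) where

  private
    module P = Poset P
    module Q = Poset Q

  mono∧cancel⇒embeds : (f : P.Carrier → Q.Carrier) →
    (∀ {x y} → x P.≤ y → f x Q.≤ f y) →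
    (∀ {x y} → f x Q.≤ f y → x P.≤ y) →
    Embeds P Q
  mono∧cancel⇒embeds f mono cancel = f , record
    { isOrderHomomorphism = record
      { cong = λ x≈y → Q.antisym (mono (P.reflexive x≈y))
                                 (mono (P.reflexive (P.Eq.sym x≈y)))
      ; mono = mono
      }
    ; injective = λ fx≈fy → P.antisym (cancel (Q.reflexive fx≈fy))
                                      (cancel (Q.reflexive (Q.Eq.sym fx≈fy)))
    ; cancel = cancel
    }

-- An enumeration of the rationals

nextPair : ℕ × ℕ → ℕ × ℕ
nextPair (zero  , n) = suc n , zero
nextPair (suc m , n) = m , suc n

-- Cantor's enumeration of pairs: each antidiagonal is walked from `(s , 0)` to `(0 , s)`, then the
-- next one begins.
unpair : ℕ → ℕ × ℕ
unpair zero    = zero , zero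
unpair (suc i) = nextPair (unpair i)

unpair-surjective : ∀ m n → ∃ λ i → unpair i ≡ (m , n)
unpair-surjective m n = antidiagonal (m + n) m n refl
  where
  antidiagonal : ∀ s m n → m + n ≡ s → ∃ λ i → unpair i ≡ (m , n)
  antidiagonal s zero zero _ = zero , refl
  antidiagonal (suc s) (suc m) zero eq
    with i , p ← antidiagonal s zero m
                   (trans (sym (+-identityʳ m)) (suc-injective eq))
    = suc i , cong nextPair p
  antidiagonal s m (suc n) eq
    with i , p ← antidiagonal s (suc m) n (trans (sym (+-suc m n)) eq)
    = suc i , cong nextPair p

-- The difference `m ⊖ n` gives numerators of both signs and `suc d` a nonzero denominator.
-- Repetitions are harmless, as only surjectivity is used.
enumℚ : ℕ → ℚ
enumℚ i = let m , j = unpair i; n , d = unpair j in (m ⊖ n) ℚ./ suc d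

enumℚ-hits : ∀ m n d → ∃ λ i → enumℚ i ≡ (m ⊖ n) ℚ./ suc d
enumℚ-hits m n d
  with j , q ← unpair-surjective n d
  with i , p ← unpair-surjective m j
  = i , trans (cong (λ (m , j) → let n , d = unpair j in (m ⊖ n) ℚ./ suc d) p)
              (cong (λ (n , d) → (m ⊖ n) ℚ./ suc d) q)

enumℚ-surjective : ∀ q → ∃ λ i → enumℚ i ≡ q
enumℚ-surjective q@(mkℚ (+ m) d _)
  with i , p ← enumℚ-hits m 0 d = i , trans p (ℚ.↥p/↧p≡p q)
enumℚ-surjective q@(mkℚ -[1+ n ] d _)
  with i , p ← enumℚ-hits 0 (suc n) d = i , trans p (ℚ.↥p/↧p≡p q)

-- Cantor's embedding of the rationals into a chain

-- A rational q is located by comparing it with enumℚ 0, enumℚ 1, ... and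
-- halving a ◁-interval at each comparison, until q itself is reached.
module Cantor {a ℓ₁ ℓ₂ ℓ} (L : TotalOrder a ℓ₁ ℓ₂)
  (_◁_ : Rel (TotalOrder.Carrier L) ℓ)
  (◁⇒≱ : ∀ {x y} → x ◁ y → ¬ TotalOrder._≤_ L y x)
  (◁-dense : ∀ {x y} → x ◁ y → ∃ λ z → x ◁ z × z ◁ y)
  where

  open TotalOrder L using (_≤_; total; poset)
    renaming (Carrier to X; refl to ≤-refl; trans to ≤-trans)

  private
    _<_ : Rel X _
    x < y = ¬ y ≤ x

    <⇒≤ : ∀ {x y} → x < y → x ≤ y
    <⇒≤ {x} {y} x<y = [ id , (λ y≤x → contradiction y≤x x<y) ]′ (total x y)

    <-trans : ∀ {x y z} → x < y → y < z → x < z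
    <-trans x<y y<z z≤x = y<z (≤-trans z≤x (<⇒≤ x<y))

  mid : ∀ {x y} → x ◁ y → X
  mid = proj₁ ∘ ◁-dense

  left : ∀ {x y} (x◁y : x ◁ y) → x ◁ mid x◁y
  left = proj₁ ∘ proj₂ ∘ ◁-dense

  right : ∀ {x y} (x◁y : x ◁ y) → mid x◁y ◁ y
  right = proj₂ ∘ proj₂ ∘ ◁-dense

  locate : ℕ → (ℕ → ℚ) → ∀ {x y} → x ◁ y → ℚ → X
  -- The counter is an index `i` with `e i ≡ q`, so when it reaches `zero` the current term `e 0` is
  -- `q` itself, as in the case `tri≈`.
  locate zero    e x◁y q = mid x◁y
  locate (suc i) e x◁y q with ℚ.<-cmp q (e 0)
  ... | tri< _ _ _ = locate i (e ∘ suc) (left x◁y) q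
  ... | tri≈ _ _ _ = mid x◁y
  ... | tri> _ _ _ = locate i (e ∘ suc) (right x◁y) q

  lower : ∀ i e {x y} (x◁y : x ◁ y) q → x < locate i e x◁y q
  lower zero    e x◁y q = ◁⇒≱ (left x◁y)
  lower (suc i) e x◁y q with ℚ.<-cmp q (e 0)
  ... | tri< _ _ _ = lower i (e ∘ suc) (left x◁y) q
  ... | tri≈ _ _ _ = ◁⇒≱ (left x◁y)
  ... | tri> _ _ _ = <-trans (◁⇒≱ (left x◁y)) (lower i (e ∘ suc) (right x◁y) q)

  upper : ∀ i e {x y} (x◁y : x ◁ y) q → locate i e x◁y q < y
  upper zero    e x◁y q = ◁⇒≱ (right x◁y)
  upper (suc i) e x◁y q with ℚ.<-cmp q (e 0)
  ... | tri< _ _ _ = <-trans (upper i (e ∘ suc) (left x◁y) q) (◁⇒≱ (right x◁y))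
  ... | tri≈ _ _ _ = ◁⇒≱ (right x◁y)
  ... | tri> _ _ _ = upper i (e ∘ suc) (right x◁y) q

  -- Both searches make the same turns until a term `e 0` equals `p` or `q` or lies between them.
  -- The midpoint reached there separates the two results, by `lower` and `upper`.
  locate-mono-< : ∀ i j e {x y} (x◁y : x ◁ y) {p q} → e i ≡ p → e j ≡ q →
    p ℚ.< q → locate i e x◁y p < locate j e x◁y q
  locate-mono-< zero zero e x◁y refl refl p<q = contradiction p<q (ℚ.<-irrefl refl)
  locate-mono-< zero (suc j) e x◁y {q = q} refl eq p<q with ℚ.<-cmp q (e 0)
  ... | tri< _ _ ¬q>e = contradiction p<q ¬q>e
  ... | tri≈ _ _ ¬q>e = contradiction p<q ¬q>e
  ... | tri> _ _ _    = lower j (e ∘ suc) (right x◁y) q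
  locate-mono-< (suc i) zero e x◁y {p = p} ep refl p<q with ℚ.<-cmp p (e 0)
  ... | tri< _ _ _    = upper i (e ∘ suc) (left x◁y) p
  ... | tri≈ ¬p<e _ _ = contradiction p<q ¬p<e
  ... | tri> ¬p<e _ _ = contradiction p<q ¬p<e
  locate-mono-< (suc i) (suc j) e x◁y {p} {q} ep eq p<q
    with ℚ.<-cmp p (e 0) | ℚ.<-cmp q (e 0)
  ... | tri< _ _ _      | tri< _ _ _      = locate-mono-< i j (e ∘ suc) (left x◁y) ep eq p<q
  ... | tri< _ _ _      | tri≈ _ _ _      = upper i (e ∘ suc) (left x◁y) p
  ... | tri< _ _ _      | tri> _ _ _      =
    <-trans (upper i (e ∘ suc) (left x◁y) p) (lower j (e ∘ suc) (right x◁y) q)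
  ... | tri≈ ¬p<e _ _   | tri< q<e _ _    = contradiction (ℚ.<-trans p<q q<e) ¬p<e
  ... | tri≈ ¬p<e _ _   | tri≈ _ refl _   = contradiction p<q ¬p<e
  ... | tri≈ _ _ _      | tri> _ _ _      = lower j (e ∘ suc) (right x◁y) q
  ... | tri> ¬p<e _ _   | tri< q<e _ _    = contradiction (ℚ.<-trans p<q q<e) ¬p<e
  ... | tri> ¬p<e _ _   | tri≈ _ refl _   = contradiction p<q ¬p<e
  ... | tri> _ _ _      | tri> _ _ _      = locate-mono-< i j (e ∘ suc) (right x◁y) ep eq p<q

  ◁⇒ℚ-embeds : ∀ {x y} → x ◁ y → Embeds ℚ-poset poset
  ◁⇒ℚ-embeds x◁y = mono∧cancel⇒embeds ℚ-poset poset φ φ-mono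
    (λ {p} {q} φp≤φq → ℚ.≮⇒≥ λ q<p → φ-mono-< q<p φp≤φq)
    where
    φ : ℚ → X
    φ q = locate (proj₁ (enumℚ-surjective q)) enumℚ x◁y q

    φ-mono-< : ∀ {p q} → p ℚ.< q → φ p < φ q
    φ-mono-< {p} {q} with i , ei≡p ← enumℚ-surjective p | j , ej≡q ← enumℚ-surjective q =
      locate-mono-< i j enumℚ x◁y ei≡p ej≡q

    φ-mono : ∀ {p q} → p ℚ.≤ q → φ p ≤ φ q
    φ-mono {p} {q} p≤q with ℚ.<-cmp p q
    ... | tri< p<q _ _ = <⇒≤ (φ-mono-< p<q)
    ... | tri≈ _ refl _ = ≤-refl
    ... | tri> _ _ q<p = contradiction (ℚ.<-≤-trans q<p p≤q) (ℚ.<-irrefl refl)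

  scattered⇒¬◁ : Scattered poset → ∀ {x y} → ¬ (x ◁ y)
  scattered⇒¬◁ scattered = scattered ∘ ◁⇒ℚ-embeds

totalOrder : {A : Set a} {_≈_ : Rel A ℓ₁} {_≤_ : Rel A ℓ₂} →
  IsTotalOrder _≈_ _≤_ → TotalOrder a ℓ₁ ℓ₂
totalOrder isTotal = record { isTotalOrder = isTotal }

-- Classical logic and characteristic functions

module Classical (em : ∀ {a} → ExcludedMiddle a) where

  private
    dne : {A : Set a} → ¬ ¬ A → A
    dne = em⇒dne em

  ¬∀⇒∃¬ : {A : Set a} {B : A → Set b} → ¬ (∀ x → B x) → ∃ λ x → ¬ B x
  ¬∀⇒∃¬ ¬∀ = dne λ ¬∃ → ¬∀ λ x → dne λ ¬Bx → ¬∃ (x , ¬Bx)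

  ¬⇒⇒× : {A : Set a} {B : Set b} → ¬ (A → B) → A × ¬ B
  ¬⇒⇒× ¬f = dne (λ ¬p → ¬f λ x → dne λ ¬y → ¬p (x , ¬y))

  dec-true⁻¹ : {A : Set a} (A? : Dec A) → does A? ≡ true → A
  dec-true⁻¹ (yes x) _ = x

  module _ (P : Poset ℓ ℓ ℓ) (X : Pred (Poset.Carrier P) ℓ)
    (resp : ∀ {x y} → Poset._≈_ P x y → x ∈ X → y ∈ X) where

    char : 2^ P
    char = record
      { to   = λ x → does (em {P = X x})
      ; cong = λ x≈y → does-⇔ (mk⇔ (resp x≈y) (resp (Poset.Eq.sym P x≈y))) em em
      }

    member⇒∈ : member P char ⊆ X
    member⇒∈ = dec-true⁻¹ em

    ∈⇒member : X ⊆ member P char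
    ∈⇒member = dec-true em

  -- Lexicographic orders on a product of chains

  module Lex {n} (C : Fin n → TotalOrder ℓ ℓ ℓ) where

    private
      module C (i : Fin n) = TotalOrder (C i)

      X : Set ℓ
      X = ∀ i → C.Carrier i

    -- In a chain `¬ y ≤ x` is the strict inequality. Earlier coordinates in the list have priority;
    -- antisymmetry gives agreement on the listed coordinates only.
    LexLE : List (Fin n) → Rel X ℓ
    LexLE []       x y = ⊤
    LexLE (i ∷ is) x y =
      ¬ C._≤_ i (y i) (x i) ⊎ (C._≈_ i (x i) (y i) × LexLE is x y)

    lex-head : ∀ i is {x y} → LexLE (i ∷ is) x y → C._≤_ i (x i) (y i)
    lex-head i is (inj₁ y≰x) with C.total i _ _
    ... | inj₁ x≤y = x≤y
    ... | inj₂ y≤x = contradiction y≤x y≰x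
    lex-head i is (inj₂ (x≈y , _)) = C.reflexive i x≈y

    ≤⇒lex : ∀ is {x y} → (∀ i → C._≤_ i (x i) (y i)) → LexLE is x y
    ≤⇒lex []       x≤y = _
    ≤⇒lex (i ∷ is) {x} {y} x≤y with em {P = C._≤_ i (y i) (x i)}
    ... | yes y≤x = inj₂ (C.antisym i (x≤y i) y≤x , ≤⇒lex is x≤y)
    ... | no  y≰x = inj₁ y≰x

    lex-trans : ∀ is {x y z} → LexLE is x y → LexLE is y z → LexLE is x z
    lex-trans []       _ _ = _
    lex-trans (i ∷ is) (inj₁ y≰x) yz =
      inj₁ λ z≤x → y≰x (C.trans i (lex-head i is yz) z≤x)
    lex-trans (i ∷ is) xy@(inj₂ _) (inj₁ z≰y) =
      inj₁ λ z≤x → z≰y (C.trans i z≤x (lex-head i is xy))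
    lex-trans (i ∷ is) (inj₂ (x≈y , xy)) (inj₂ (y≈z , yz)) =
      inj₂ (C.Eq.trans i x≈y y≈z , lex-trans is xy yz)

    lex-antisym : ∀ is {x y} → LexLE is x y → LexLE is y x →
      All (λ i → C._≈_ i (x i) (y i)) is
    lex-antisym []       _  _  = []
    lex-antisym (i ∷ is) (inj₁ y≰x) yx = contradiction (lex-head i is yx) y≰x
    lex-antisym (i ∷ is) xy@(inj₂ _) (inj₁ x≰y) =
      contradiction (lex-head i is xy) x≰y
    lex-antisym (i ∷ is) (inj₂ (x≈y , xy)) (inj₂ (_ , yx)) =
      x≈y ∷ lex-antisym is xy yx

    lex-total : ∀ is x y → LexLE is x y ⊎ LexLE is y x
    lex-total []       x y = inj₁ _
    lex-total (i ∷ is) x y with em {P = C._≤_ i (y i) (x i)}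
    ... | no  y≰x = inj₁ (inj₁ y≰x)
    ... | yes y≤x with em {P = C._≤_ i (x i) (y i)}
    ...   | no  x≰y = inj₂ (inj₁ x≰y)
    ...   | yes x≤y with x≈y ← C.antisym i x≤y y≤x | lex-total is x y
    ...     | inj₁ xy = inj₁ (inj₂ (x≈y , xy))
    ...     | inj₂ yx = inj₂ (inj₂ (C.Eq.sym i x≈y , yx))

    module _ (scattered : ∀ i → Scattered (C.poset i)) (g : ℚ → X) where

      LexMonoOn : List (Fin n) → ℚ → ℚ → Set ℓ
      LexMonoOn is p q =
        ∀ {r s} → p ℚ.≤ r → r ℚ.≤ s → s ℚ.≤ q → LexLE is (g r) (g s)

      AgreeWithin : List (Fin n) → ℚ → ℚ → Set ℓ
      AgreeWithin is p q = ∃₂ λ r s → p ℚ.≤ r × r ℚ.< s × s ℚ.≤ q ×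
        All (λ i → C._≈_ i (g r i) (g s i)) is

      -- Otherwise the head coordinate would be strictly increasing on the interval, and the
      -- relation `◁` between its values at `r < s` would inherit density from the rationals.
      agree-head : ∀ i is {p q} → p ℚ.< q → LexMonoOn (i ∷ is) p q →
        AgreeWithin (i ∷ []) p q
      agree-head i is {p} {q} p<q mono = dne λ ¬agree →
        let
          _◁_ : Rel (C.Carrier i) ℓ
          x ◁ y = ∃₂ λ r s → p ℚ.≤ r × r ℚ.< s × s ℚ.≤ q × g r i ≡ x × g s i ≡ y

          ◁⇒≱ : ∀ {x y} → x ◁ y → ¬ C._≤_ i y x
          ◁⇒≱ = λ
            { (r , s , p≤r , r<s , s≤q , refl , refl) y≤x →
              let x≤y = lex-head i is (mono p≤r (ℚ.<⇒≤ r<s) s≤q)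
              in ¬agree (r , s , p≤r , r<s , s≤q , C.antisym i x≤y y≤x ∷ []) }

          ◁-dense : ∀ {x y} → x ◁ y → ∃ λ z → x ◁ z × z ◁ y
          ◁-dense = λ
            { (r , s , p≤r , r<s , s≤q , gr , gs) →
              let t , r<t , t<s = ℚ.<-dense r<s in
              g t i ,
              (r , t , p≤r , r<t , ℚ.≤-trans (ℚ.<⇒≤ t<s) s≤q , gr , refl) ,
              (t , s , ℚ.≤-trans p≤r (ℚ.<⇒≤ r<t) , t<s , s≤q , refl , gs) }
        in
        Cantor.scattered⇒¬◁ (C i) _◁_ ◁⇒≱ ◁-dense (scattered i)
          (p , q , ℚ.≤-refl , p<q , ℚ.≤-refl , refl , refl)

      -- A monotone head coordinate with equal values at both ends is constant in between, so the
      -- comparison falls to the remaining coordinates.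
      squeeze : ∀ {i is p q} → LexMonoOn (i ∷ is) p q →
        C._≈_ i (g p i) (g q i) →
        ∀ {r s} → p ℚ.≤ r → r ℚ.≤ s → s ℚ.≤ q →
        C._≈_ i (g r i) (g s i) × LexLE is (g r) (g s)
      squeeze {i} {is} mono gp≈gq p≤r r≤s s≤q
        with mono p≤r r≤s s≤q
      ... | inj₂ agree = agree
      ... | inj₁ gs≰gr = contradiction
        (C.trans i (lex-head i is (mono (ℚ.≤-trans p≤r r≤s) s≤q ℚ.≤-refl))
          (C.trans i (C.reflexive i (C.Eq.sym i gp≈gq))
            (lex-head i is (mono ℚ.≤-refl p≤r (ℚ.≤-trans r≤s s≤q)))))
        gs≰gr

      -- The interval shrinks once per coordinate; after `agree-head`, `squeeze` makes the map
      -- monotone for the tail of the list.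
      agree-within : ∀ is {p q} → p ℚ.< q → LexMonoOn is p q → AgreeWithin is p q
      agree-within [] p<q mono = _ , _ , ℚ.≤-refl , p<q , ℚ.≤-refl , []
      agree-within (i ∷ is) p<q mono =
        let
          p₁ , q₁ , p≤p₁ , p₁<q₁ , q₁≤q , gp₁≈gq₁ = agree-head i is p<q mono
          mono₁ : LexMonoOn (i ∷ is) p₁ q₁
          mono₁ = λ p₁≤r r≤s s≤q₁ →
            mono (ℚ.≤-trans p≤p₁ p₁≤r) r≤s (ℚ.≤-trans s≤q₁ q₁≤q)
          p₂ , q₂ , p₁≤p₂ , p₂<q₂ , q₂≤q₁ , gp₂≈gq₂ =
            agree-within is p₁<q₁ λ p₁≤r r≤s s≤q₁ →
              proj₂ (squeeze mono₁ (All.head gp₁≈gq₁) p₁≤r r≤s s≤q₁)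
        in
        p₂ , q₂ , ℚ.≤-trans p≤p₁ p₁≤p₂ , p₂<q₂ , ℚ.≤-trans q₂≤q₁ q₁≤q ,
        proj₁ (squeeze mono₁ (All.head gp₁≈gq₁) p₁≤p₂ (ℚ.<⇒≤ p₂<q₂) q₂≤q₁) ∷ gp₂≈gq₂

  -- From a product embedding to an intersection of linear orders

  embeds⇒intersection : ∀ {n} (P : Poset ℓ ℓ ℓ) (C : Fin n → TotalOrder ℓ ℓ ℓ) →
    (∀ i → Scattered (TotalOrder.poset (C i))) →
    Embeds P (Product (λ i → TotalOrder.poset (C i))) →
    IsIntersectionOfScatteredLinearOrders n P
  embeds⇒intersection {ℓ} {n} P C scattered (f , f-mono) =
    R , R-isTotal , R-scattered , λ x y → mk⇔
      (λ x≤y i → ≤⇒lex (i ∷ allFin n) (F.mono x≤y))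
      (λ Rxy → F.cancel λ i → lex-head i (allFin n) (Rxy i))
    where
    open Poset P using (Carrier; _≈_; module Eq)
    open Lex C
    module C i = TotalOrder (C i)
    module F = IsOrderMonomorphism f-mono

    -- The second occurrence of `i`, inside `allFin n`, is harmless: it is compared only once the
    -- two points agree at `i`.
    R : Fin n → Rel Carrier ℓ
    R i x y = LexLE (i ∷ allFin n) (f x) (f y)

    agree⇒≈ : ∀ i {x y} → All (λ j → C._≈_ j (f x j) (f y j)) (i ∷ allFin n) → x ≈ y
    agree⇒≈ i agree = F.injective λ j → All.lookup agree (there (∈-allFin j))

    R-isTotal : ∀ i → IsTotalOrder _≈_ (R i)
    R-isTotal i = record
      { isPartialOrder = record
        { isPreorder = record
          { isEquivalence = Eq.isEquivalence
          ; reflexive     = λ x≈y →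
              ≤⇒lex (i ∷ allFin n) (λ j → C.reflexive j (F.cong x≈y j))
          ; trans         = lex-trans (i ∷ allFin n)
          }
        ; antisym = λ xy yx → agree⇒≈ i (lex-antisym (i ∷ allFin n) xy yx)
        }
      ; total = λ x y → lex-total (i ∷ allFin n) (f x) (f y)
      }

    R-scattered : ∀ i → Scattered (TotalOrder.poset (totalOrder (R-isTotal i)))
    R-scattered i (g , g-mono) =
      let
        p , q , _ , p<q , _ , agree =
          agree-within scattered (f ∘ g) (i ∷ allFin n) 0<1 (λ _ r≤s _ → G.mono r≤s)
      in ℚ.<-irrefl (G.injective (agree⇒≈ i {g p} {g q} agree)) p<q
      where module G = IsOrderMonomorphism g-mono

  -- Chains of initial segments

  Segments : TotalOrder ℓ ℓ ℓ → TotalOrder ℓ ℓ ℓ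
  Segments L = record
    { isTotalOrder = record
      { isPartialOrder = Poset.isPartialOrder segments
      ; total          = total
      }
    }
    where
    module L = TotalOrder L

    segments : Poset _ _ _
    segments = On.poset (𝔓 L.poset) (proj₁ {B = λ J →
      ∀ {x y} → x L.≤ y → y ∈ member L.poset J → x ∈ member L.poset J})

    open Poset segments using (Carrier; _≤_)

    total : ∀ J K → J ≤ K ⊎ K ≤ J
    total J K with em {P = J ≤ K}
    ... | yes J≤K = inj₁ J≤K
    ... | no  J≰K
      with x , ¬x ← ¬∀⇒∃¬ J≰K
      with x∈J , x∉K ← ¬⇒⇒× ¬x
      -- The point `x` lies in `J` but not in `K`, so every point of `K` is below it.
      = inj₂ λ y y∈K → [ (λ x≤y → contradiction (proj₂ K x≤y y∈K) x∉K)
                       , (λ y≤x → proj₂ J y≤x x∈J) ]′ (L.total x y)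

  -- For a copy of the rationals among the segments, `x ◁ y` says that some `p < q` have `x` inside
  -- the segment of `p` and `y` outside that of `q`. A point in the gap between two intermediate
  -- segments shows that `◁` is dense.
  Segments-scattered : (L : TotalOrder ℓ ℓ ℓ) → Scattered (TotalOrder.poset L) →
    Scattered (TotalOrder.poset (Segments L))
  Segments-scattered L scattered (f , f-mono) =
    Cantor.scattered⇒¬◁ L _◁_ ◁⇒≱ ◁-dense scattered (
      let
        s , 0<s , s<1 = ℚ.<-dense 0<1
        r , 0<r , r<s = ℚ.<-dense 0<s
        _ , x∈r , _ = gap 0<r
        _ , _ , y∉s = gap s<1
      in r , s , r<s , x∈r , y∉s)
    where
    open TotalOrder L using (Carrier; _≤_; poset)
    module F = IsOrderMonomorphism f-mono

    In : ℚ → Pred Carrier _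
    In q = member poset (proj₁ (f q))

    _◁_ : Rel Carrier _
    x ◁ y = ∃₂ λ p q → p ℚ.< q × x ∈ In p × y ∉ In q

    gap : ∀ {p q} → p ℚ.< q → ∃ λ z → z ∈ In q × z ∉ In p
    gap p<q =
      let z , ¬z = ¬∀⇒∃¬ λ fq≤fp → ℚ.<-irrefl refl (ℚ.<-≤-trans p<q (F.cancel fq≤fp))
      in z , ¬⇒⇒× ¬z

    ◁⇒≱ : ∀ {x y} → x ◁ y → ¬ y ≤ x
    ◁⇒≱ (p , q , p<q , x∈p , y∉q) y≤x =
      y∉q (F.mono (ℚ.<⇒≤ p<q) _ (proj₂ (f p) y≤x x∈p))

    ◁-dense : ∀ {x y} → x ◁ y → ∃ λ z → x ◁ z × z ◁ y
    ◁-dense (p , q , p<q , x∈p , y∉q) =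
      let
        s , p<s , s<q = ℚ.<-dense p<q
        r , p<r , r<s = ℚ.<-dense p<s
        z , z∈s , z∉r = gap r<s
      in z , (p , r , p<r , x∈p , z∉r) , (s , q , s<q , z∈s , y∉q)

  -- Principal initial segments in the closure

  P-embeds-N̄ : (P : Poset ℓ ℓ ℓ) → Embeds P (N̄-poset P)
  P-embeds-N̄ P = mono∧cancel⇒embeds P (N̄-poset P)
    -- A one-member intersection lies in `N P`, and hence in the closure: it is its own witness in
    -- each of its neighbourhoods.
    (λ x → ↓ᶜ x , λ U _ x∈U → ↓ᶜ x , ↓ᶜ∈N x , x∈U)
    (λ x≤y z z∈ → ∈⇒member P _ (↓-resp _) (P.trans (member⇒∈ P _ (↓-resp _) z∈) x≤y))
    (λ {x} ↓x≤↓y → member⇒∈ P _ (↓-resp _)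
      (↓x≤↓y x (∈⇒member P _ (↓-resp _) P.refl)))
    where
    module P = Poset P

    ↓-resp : ∀ x {y z} → y P.≈ z → y P.≤ x → z P.≤ x
    ↓-resp x y≈z y≤x = P.trans (P.reflexive (P.Eq.sym y≈z)) y≤x

    ↓ᶜ : P.Carrier → 2^ P
    ↓ᶜ x = char P (↓ P x) (↓-resp x)

    ↓ᶜ∈N : ∀ x → ↓ᶜ x ∈ N P
    ↓ᶜ∈N x = ⊤ , (λ _ → x) ,
      (λ y∈ _ → member⇒∈ P _ (↓-resp x) y∈) , (λ y≤x → ∈⇒member P _ (↓-resp x) (y≤x _))

  -- Initial segments generated by members of the closure

  module Intersection (P : Poset ℓ ℓ ℓ) {n}
    (R : Fin n → Rel (Poset.Carrier P) ℓ)
    (isTotal : ∀ i → IsTotalOrder (Poset._≈_ P) (R i))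
    (scattered : ∀ i → Scattered (TotalOrder.poset (totalOrder (isTotal i))))
    (≤⇔R : ∀ x y → Poset._≤_ P x y ⇔ (∀ i → R i x y))
    where

    private
      module R i = IsTotalOrder (isTotal i)

    open Poset P using (Carrier; _≈_; module Eq)

    L : Fin n → TotalOrder ℓ ℓ ℓ
    L i = totalOrder (isTotal i)

    -- This is `x ∈ ↓ᵢ A` with `A` as the variable, so that it is a subset of `2^ P` which can split
    -- families.
    Below : Fin n → Carrier → Pred (2^ P) ℓ
    Below i x A = ∃ λ y → y ∈ member P A × R i x y

    ∈⇒Below : ∀ i {x A} → x ∈ member P A → A ∈ Below i x
    ∈⇒Below i x∈A = _ , x∈A , R.refl i

    Below-anti : ∀ i {x y} → R i x y → ∀ {A} → A ∈ Below i y → A ∈ Below i x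
    Below-anti i x≤y (z , z∈A , y≤z) = z , z∈A , R.trans i x≤y y≤z

    -- For A in N P this holds because A is an intersection of sets
    -- ↓ z = ⋂ᵢ { x ∣ R i x z }; as each instance involves only the point x and
    -- one witness per i, it passes to the closure.
    N̄⇒⋂Below : ∀ {A} → A ∈ N̄ P → ∀ {x} → (∀ i → A ∈ Below i x) → x ∈ member P A
    N̄⇒⋂Below {A} A∈N̄ {x} A∈Below with Func.to A x in Ax
    ... | true  = refl
    ... | false = contradiction
      (trans (sym x∈B) x∉B) λ ()
      where
      ys : List Carrier
      ys = tabulate (proj₁ ∘ A∈Below)

      U : Pred (2^ P) ℓ
      U B = Func.to B x ≡ false × All (member P B) ys

      U-open : IsOpen P U
      U-open B (x∉B , ys∈B) = x ∷ ys , λ C → λ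
        { (Bx≡Cx ∷ B≡C) → trans (sym Bx≡Cx) x∉B ,
          All.zipWith (λ (B≡C , y∈B) → trans (sym B≡C) y∈B) (B≡C , ys∈B) }

      near : Satisfiable (N P ∩ U)
      near = A∈N̄ U U-open (Ax , tabulate⁺ (proj₁ ∘ proj₂ ∘ A∈Below))

      B = proj₁ near
      x∉B = proj₁ (proj₂ (proj₂ near))

      x∈B : x ∈ member P B
      x∈B with _ , (I , f , B⊆⋂ , ⋂⊆B) , _ , ys∈B ← near =
        ⋂⊆B λ j → Equivalence.from (≤⇔R _ _) λ i →
          R.trans i (proj₂ (proj₂ (A∈Below i)))
            (Equivalence.to (≤⇔R _ _) (B⊆⋂ (tabulate⁻ ys∈B i) j) i)

    N̄-embeds : EmbedsInProductOfScatteredLinearOrders ℓ n (N̄-poset P)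
    N̄-embeds = Segments ∘ L , (λ i → Segments-scattered (L i) (scattered i)) ,
      mono∧cancel⇒embeds (N̄-poset P) (Product λ i → TotalOrder.poset (Segments (L i)))
        (λ A i → segment i (proj₁ A))
        (λ {A} {B} A≤B i x x∈ →
          let y , y∈A , x≤y = segment⇒Below i (proj₁ A) x∈
          in Below⇒segment i (proj₁ B) (y , A≤B y y∈A , x≤y))
        -- A point of `A` lies in all segments of `A`, hence in all those of `B`, and `B` is the
        -- intersection of its segments.
        (λ {A} {B} A≤B x x∈A → N̄⇒⋂Below (proj₂ B) λ i →
          segment⇒Below i (proj₁ B)
            (A≤B i x (Below⇒segment i (proj₁ A) (∈⇒Below i {A = proj₁ A} x∈A))))
      where
      module _ (i : Fin n) (A : 2^ P) where
        Lᵢ : Poset ℓ ℓ ℓ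
        Lᵢ = TotalOrder.poset (L i)

        Below-resp : ∀ {x y} → x ≈ y → A ∈ Below i x → A ∈ Below i y
        Below-resp x≈y = Below-anti i (R.reflexive i (Eq.sym x≈y)) {A}

        segmentᶜ : 2^ Lᵢ
        segmentᶜ = char Lᵢ (λ x → A ∈ Below i x) Below-resp

        segment⇒Below : ∀ {x} → x ∈ member Lᵢ segmentᶜ → A ∈ Below i x
        segment⇒Below = member⇒∈ Lᵢ (λ x → A ∈ Below i x) Below-resp

        Below⇒segment : ∀ {x} → A ∈ Below i x → x ∈ member Lᵢ segmentᶜ
        Below⇒segment = ∈⇒member Lᵢ (λ x → A ∈ Below i x) Below-resp

        segment : TotalOrder.Carrier (Segments (L i))
        segment = segmentᶜ , λ x≤y y∈ →
          Below⇒segment (Below-anti i x≤y {A} (segment⇒Below y∈))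

    -- Large families that no segment condition splits

    module Unsplit {ℓ′} (Large : Pred (Pred (2^ P) (Level.suc ℓ)) ℓ′)
      (large-mono : ∀ {M N} → M ⊆ N → Large M → Large N)
      (large-satisfiable : ∀ {M} → Large M → Satisfiable M)
      where

      Splits : Pred (2^ P) (Level.suc ℓ) → Pred (2^ P) ℓ → Set ℓ′
      Splits M X = Large (M ∩ X) × Large (M ∩ ∁ X)

      Unsplittable : Pred (2^ P) (Level.suc ℓ) → Pred (Fin n) (ℓ ⊔ ℓ′)
      Unsplittable M i = ∀ x → ¬ Splits M (Below i x)

      unsplittable-anti : ∀ {i M N} → M ⊆ N → Unsplittable N i → Unsplittable M i
      unsplittable-anti M⊆N unsplit x (large∈ , large∉) = unsplit x
        ( large-mono (λ (A∈M , A∈) → M⊆N A∈M , A∈) large∈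
        , large-mono (λ (A∈M , A∉) → M⊆N A∈M , A∉) large∉ )

      HasUnsplittable : Pred (2^ P) (Level.suc ℓ) → Fin n →
        Set (Level.suc (Level.suc ℓ) ⊔ ℓ′)
      HasUnsplittable M i = ∃ λ N → N ⊆ M × Large N × Unsplittable N i

      -- Otherwise every large part of `M` is split. Let `x ◁ y` mean that the members of `M` with
      -- `x` but not `y` in `↓ᵢ A` form a large family: splitting it at `z` gives `x ◁ z` and
      -- `z ◁ y`. Two initial splits provide a pair in `◁`.
      unsplittable-at : ∀ i M → Large M → HasUnsplittable M i
      unsplittable-at i M large = dne {A = HasUnsplittable M i} λ ¬unsplit →
        let
          split : ∀ N → N ⊆ M → Large N → ∃ λ x → Splits N (Below i x)
          split = λ N N⊆M large → dne λ ¬split →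
            ¬unsplit (N , N⊆M , large , λ x splits → ¬split (x , splits))

          _◁_ : Rel Carrier ℓ′
          x ◁ y = Large ((M ∩ Below i x) ∩ ∁ (Below i y))

          ◁⇒≱ : ∀ {x y} → x ◁ y → ¬ R i y x
          ◁⇒≱ = λ x◁y y≤x →
            let A , (_ , A∈x) , A∉y = large-satisfiable x◁y
            in A∉y (Below-anti i y≤x {A} A∈x)

          ◁-dense : ∀ {x y} → x ◁ y → ∃ λ z → x ◁ z × z ◁ y
          ◁-dense = λ {x} {y} x◁y →
            let z , large∈ , large∉ = split _ (λ ((A∈M , _) , _) → A∈M) x◁y in
            z , large-mono (λ ((A∈Mx , _) , A∉z) → A∈Mx , A∉z) large∉
              , large-mono (λ (((A∈M , _) , A∉y) , A∈z) → (A∈M , A∈z) , A∉y) large∈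

          x , large-x , _ = split M id large
          y , _ , x◁y     = split _ proj₁ large-x
        in Cantor.scattered⇒¬◁ (L i) _◁_ ◁⇒≱ ◁-dense (scattered i) x◁y

      unsplittable : ∀ is M → Large M →
        ∃ λ N → N ⊆ M × Large N × All (Unsplittable N) is
      unsplittable []       M large = M , id , large , []
      unsplittable (i ∷ is) M large =
        let
          N  , N⊆M  , large-N  , unsplit-i  = unsplittable-at i M large
          N′ , N′⊆N , large-N′ , unsplit-is = unsplittable is N large-N
        in N′ , N⊆M ∘ N′⊆N , large-N′ , unsplittable-anti N′⊆N unsplit-i ∷ unsplit-is

    -- Sets without isolated points

    module DenseInItself (S : Pred (2^ P) (Level.suc ℓ)) (S⊆N̄ : S ⊆ N̄ P)
      (¬isolated : ¬ Satisfiable (IsIsolatedIn P S)) where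

      -- Somewhere dense in S.
      Large : Pred (Pred (2^ P) (Level.suc ℓ)) (Level.suc ℓ)
      Large M = ∃ λ U → IsOpen P U × Satisfiable (S ∩ U) ×
        (∀ V → IsOpen P V → V ⊆ U → Satisfiable (S ∩ V) → Satisfiable (S ∩ V ∩ M))

      large-mono : ∀ {M N} → M ⊆ N → Large M → Large N
      large-mono M⊆N (U , U-open , U-meets , dense) =
        U , U-open , U-meets , λ V V-open V⊆U V-meets →
          let A , A∈S , A∈V , A∈M = dense V V-open V⊆U V-meets
          in A , A∈S , A∈V , M⊆N A∈M

      large-meets : ∀ {M} → Large M → Satisfiable (S ∩ M)
      large-meets (U , U-open , U-meets , dense) =
        let A , A∈S , _ , A∈M = dense U U-open id U-meets in A , A∈S , A∈M

      large-satisfiable : ∀ {M} → Large M → Satisfiable M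
      large-satisfiable large = let A , _ , A∈M = large-meets large in A , A∈M

      -- If `M ∩ X zero` is not dense in `U`, it misses some open `V ⊆ U` that meets `S`. There the
      -- rest of `M` is dense and is covered by the remaining sets.
      large-cover : ∀ {m M} (X : Fin m → Pred (2^ P) ℓ) →
        (∀ {A} → A ∈ S → A ∈ M → ∃ λ i → A ∈ X i) →
        Large M → ∃ λ i → Large (M ∩ X i)
      large-cover {zero} X cover large
        with _ , A∈S , A∈M ← large-meets large
        with () ← proj₁ (cover A∈S A∈M)
      large-cover {suc m} {M} X cover large@(U , U-open , U-meets , dense)
        with em {P = Large (M ∩ X zero)}
      ... | yes large₀ = zero , large₀
      ... | no ¬large₀
        with V , ¬V₁ ← ¬∀⇒∃¬ (λ ∀V → ¬large₀ (U , U-open , U-meets , ∀V))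
        with V-open , ¬V₂ ← ¬⇒⇒× ¬V₁
        with V⊆U , ¬V₃ ← ¬⇒⇒× {A = V ⊆ U} ¬V₂
        with V-meets , ¬V₄ ← ¬⇒⇒× ¬V₃
        with i , large′ ← large-cover {M = M ∩ ∁ (X zero)} (X ∘ suc)
          (λ A∈S (A∈M , A∉X₀) → case cover A∈S A∈M of λ
            { (zero  , A∈X₀) → contradiction A∈X₀ A∉X₀
            ; (suc i , A∈X)  → i , A∈X })
          (V , V-open , V-meets , λ W W-open W⊆V W-meets →
            let A , A∈S , A∈W , A∈M = dense W W-open (V⊆U ∘ W⊆V) W-meets in
            A , A∈S , A∈W , A∈M , λ A∈X₀ → ¬V₄ (A , A∈S , W⊆V A∈W , A∈M , A∈X₀))
        = suc i , large-mono (λ ((A∈M , _) , A∈X) → A∈M , A∈X) large′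

      At : Carrier → Bool → Pred (2^ P) _
      At x b A = Func.to A x ≡ b

      -- A point `A` of `S ∩ U` is not isolated, so some `B` in `S ∩ U` differs from it at an `x`.
      -- As there are two truth values, both conditions at `x` meet `S ∩ U`, and `M` is dense in
      -- each of these open parts of `U`.
      large-split : ∀ {M} → Large M → ∃ λ x → ∀ b → Large (M ∩ At x b)
      large-split {M} (U , U-open , (A , A∈S , A∈U) , dense)
        with B , ¬B₁ ← ¬∀⇒∃¬ (λ ∀B → ¬isolated (A , A∈S , U , U-open , A∈U , ∀B))
        with B∈S , ¬B₂ ← ¬⇒⇒× ¬B₁
        with B∈U , B≉A ← ¬⇒⇒× ¬B₂
        with x , Bx≢Ax ← ¬∀⇒∃¬ B≉A
        = x , large-at
        where
        witness : ∀ b → Satisfiable (S ∩ U ∩ At x b)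
        witness b with Func.to A x ≟ b
        ... | yes Ax≡b = A , A∈S , A∈U , Ax≡b
        ... | no  Ax≢b = B , B∈S , B∈U ,
          trans (¬-not Bx≢Ax) (sym (¬-not (Ax≢b ∘ sym)))

        large-at : ∀ b → Large (M ∩ At x b)
        large-at b with C , C∈S , C∈U , Cx≡b ← witness b =
          U ∩ At x b , open∩ , (C , C∈S , C∈U , Cx≡b) , λ V V-open V⊆ V-meets →
            let D , D∈S , D∈V , D∈M = dense V V-open (proj₁ ∘ V⊆) V-meets
            in D , D∈S , D∈V , D∈M , proj₂ (V⊆ D∈V)
          where
          open∩ : IsOpen P (U ∩ At x b)
          open∩ E (E∈U , Ex≡b) = let F , E-nbhd = U-open E E∈U in
            x ∷ F , λ { G (Ex≡Gx ∷ E≡G) → E-nbhd G E≡G , trans (sym Ex≡Gx) Ex≡b }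

      open Unsplit Large large-mono large-satisfiable

      ¬satisfiable : ¬ Satisfiable S
      ¬satisfiable (A , A∈S) =
        let
          -- `S` is dense in itself throughout the whole space, hence large.
          M , M⊆S , large , unsplit = unsplittable (allFin n) S
            ((λ _ → ⊤) , (λ _ _ → [] , _) , (A , A∈S , _) ,
             λ { V _ _ (B , B∈S , B∈V) → B , B∈S , B∈V , B∈S })
          x , large-at = large-split large
          -- Members of `S` are intersections of their segments, so those omitting `x` are covered
          -- by the conditions `x ∉ ↓ᵢ B`; one `i` must take a large part.
          i , large∉ = large-cover (λ i → ∁ (Below i x))
            (λ {B} B∈S (_ , x∉B) → ¬∀⇒∃¬ λ B∈Below →
              case trans (sym (N̄⇒⋂Below (S⊆N̄ B∈S) B∈Below)) x∉B of λ ())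
            (large-at false)
        in All.lookup unsplit (∈-allFin i) x
          ( large-mono (λ {B} (B∈M , x∈B) → B∈M , ∈⇒Below i {A = B} x∈B) (large-at true)
          , large-mono (λ ((B∈M , _) , B∉) → B∈M , B∉) large∉ )

    N̄-scattered : TopologicallyScattered P (N̄ P)
    N̄-scattered S S⊆N̄ S-nonempty =
      dne λ ¬isolated → DenseInItself.¬satisfiable S S⊆N̄ ¬isolated S-nonempty

  -- The equivalence and topological scatteredness

  N̄-embeds⇒intersection : ∀ {n} (P : Poset ℓ ℓ ℓ) →
    EmbedsInProductOfScatteredLinearOrders ℓ n (N̄-poset P) →
    IsIntersectionOfScatteredLinearOrders n P
  N̄-embeds⇒intersection P (C , scattered , _ , N̄↪ΠC) =
    embeds⇒intersection P C scattered
      (_ , isOrderMonomorphism (proj₂ (P-embeds-N̄ P)) N̄↪ΠC)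

theorem3 : (∀ {a} → ExcludedMiddle a) →
    ∀ {ℓ : Level} (P : Poset ℓ ℓ ℓ) (n : ℕ) .{{_ : NonZero n}} →
    (IsIntersectionOfScatteredLinearOrders n P
    ⇔ EmbedsInProductOfScatteredLinearOrders ℓ n (N̄-poset P))
    × (IsIntersectionOfScatteredLinearOrders n P
    ⊎ EmbedsInProductOfScatteredLinearOrders ℓ n (N̄-poset P)
    → TopologicallyScattered P (N̄ P))
theorem3 em {ℓ} P n =
  mk⇔ (λ (R , isTotal , scattered , ≤⇔R) → N̄-embeds P R isTotal scattered ≤⇔R) ii⇒i ,
  topologicallyScattered ∘ [ id , ii⇒i ]′
  where
  open Classical em
  open Intersection

  ii⇒i : EmbedsInProductOfScatteredLinearOrders ℓ n (N̄-poset P) →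
    IsIntersectionOfScatteredLinearOrders n P
  ii⇒i = N̄-embeds⇒intersection P

  topologicallyScattered : IsIntersectionOfScatteredLinearOrders n P →
    TopologicallyScattered P (N̄ P)
  topologicallyScattered (R , isTotal , scattered , ≤⇔R) =
    N̄-scattered P R isTotal scattered ≤⇔R
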